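{- For every integer $L\geq 1$, the power series \[ \frac{1}{(q;q)_L}\sum_{n\geq1}\frac{q^{n(n+1)/2}}{(-q;q)_n(1-q^{L+n})} \] has all coefficients non-negative.
   Context: $(a;q)_n=\prod_{i=0}^{n-1}(1-aq^i)$; the expression is expanded as a formal power series in $q$. -}

module Defs where

open import Data.Nat as ℕ using (ℕ; zero; suc; _∸_; _/_)
open import Data.Integer as ℤ using (ℤ; +_; -_; _+_; _*_; _^_)
open import Relation.Nullary using (yes; no)

-- Formal power series in q with integer coefficients: k ↦ coefficient of q^k.
PS : Set
PS = ℕ → ℤ

Σ< : ℕ → (ℕ → ℤ) → ℤ
Σ< zero    f = + 0
Σ< (suc n) f = Σ< n f + f n

mono : ℕ → PS
mono d k with k ℕ.≟ d
... | yes _ = + 1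
... | no  _ = + 0

one : PS
one = mono 0

_⊛_ : PS → PS → PS
(f ⊛ g) k = Σ< (suc k) (λ i → f i * g (k ∸ i))

infixl 7 _⊛_

∏< : ℕ → (ℕ → PS) → PS
∏< zero    f = one
∏< (suc n) f = ∏< n f ⊛ f n

-- 1 / (1 - c q^(suc m)) = Σ_j c^j q^(j (m+1)), the inverse in ℤ[[q]]
geomInv : ℤ → ℕ → PS
geomInv c m k = Σ< (suc k) (λ j → mono (j ℕ.* suc m) k * (c ^ j))

invQPoch : ℕ → PS
invQPoch L = ∏< L (λ i → geomInv (+ 1) i)

invNegQPoch : ℕ → PS
invNegQPoch n = ∏< n (λ i → geomInv (- (+ 1)) i)

-- summand for n ≥ 1:  q^{n(n+1)/2} / ((-q;q)_n (1 - q^{L+n}))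
-- (L + n = suc (L + (n-1)) ≥ 1, written via geomInv's shifted exponent)
summand : ℕ → ℕ → PS
summand L n = mono ((n ℕ.* suc n) / 2) ⊛ invNegQPoch n ⊛ geomInv (+ 1) ((L ℕ.+ n) ∸ 1)

-- Σ_{n ≥ 1} summand L n.  The n-th summand is divisible by q^{n(n+1)/2},
-- and n(n+1)/2 ≥ n, so only n = 1..k contribute to the coefficient of q^k.
innerSum : ℕ → PS
innerSum L k = Σ< k (λ j → summand L (suc j) k)

theSeries : ℕ → PS
theSeries L = invQPoch L ⊛ innerSum L

-- Write A_j = q^j / (q^j;q)_(L+1). Introduce a parameter m by
--   u_(m,n) = (q^(L+1);q)_(n-1) q^(mn) q^(n(n+1)/2) / ((-q;q)_n (q^(m+1);q)_(L+n)),
-- so that the sum over n ≥ 1 of u_(0,n) is the given series. With g_(m,n) = (1 + q^n) u_(m,n) one has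
--   u_(m,n) + u_(m+1,n) = g_(m,n) - g_(m,n+1)   and   g_(m,1) = A_(m+1),
-- hence the series equals A_1 - A_2 + A_3 - A_4 + ⋯. It suffices that A_1 dominates A_2 + A_4 + ⋯.
-- By the q-binomial theorem A_j is the sum over s ≥ 1 of q^(js) times the generating function of the
-- partitions μ with at most L parts, all less than s. Send (2i copies of s, μ) to the single part
-- N = s(2i-1) + μ_1 above the partition (s, μ_2, …, μ_L): since μ_1 < s, division of N by s gives i and μ_1
-- back. The only case with N = s is i = 1, μ = ∅, and it is sent to the part 2s above the empty partition.
module Submission where

open import Defs
open import Data.Nat as ℕ using (ℕ; zero; suc; _∸_; _≥_; z≤n; s≤s)
import Data.Nat.Properties as ℕP
import Data.Nat.Tactic.RingSolver as ℕSolver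
open import Data.Nat.DivMod using (+-distrib-/-∣ˡ; m*n/n≡m)
open import Data.Nat.Divisibility using (divides-refl)
open import Data.Integer as ℤ using (ℤ; +_; -_; _+_; _*_; _^_; _≤_; +≤+)
import Data.Integer.Properties as ℤP
open import Data.Integer.Tactic.RingSolver using (solve-∀)
open import Data.Empty using (⊥-elim)
open import Data.Product using (_,_)
open import Relation.Nullary using (yes; no)
open import Relation.Nullary.Decidable using (dec⇒maybe)
open import Relation.Binary.PropositionalEquality
  using (_≡_; _≢_; refl; sym; trans; cong; cong₂; subst; module ≡-Reasoning)
open import Algebra.Bundles using (CommutativeRing)
open import Algebra.Structures using (IsCommutativeRing)
open import Level using (0ℓ)
open import Algebra.Solver.Ring.AlmostCommutativeRing
  using (fromCommutativeRing; _-Raw-AlmostCommutative⟶_)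
import Algebra.Solver.Ring
open import Data.Maybe as Maybe using (Maybe)
import Relation.Binary.Reasoning.Setoid as SetoidReasoning

-- Finite sums of integers

Σ-cong : ∀ n {f g} → (∀ i → i ℕ.< n → f i ≡ g i) → Σ< n f ≡ Σ< n g
Σ-cong zero    h = refl
Σ-cong (suc n) h =
  cong₂ _+_ (Σ-cong n (λ i i<n → h i (ℕP.m<n⇒m<1+n i<n))) (h n ℕP.≤-refl)

Σ-zero : ∀ n {f} → (∀ i → i ℕ.< n → f i ≡ + 0) → Σ< n f ≡ + 0
Σ-zero zero    h = refl
Σ-zero (suc n) h =
  cong₂ _+_ (Σ-zero n (λ i i<n → h i (ℕP.m<n⇒m<1+n i<n))) (h n ℕP.≤-refl)

Σ-+ : ∀ n f g → Σ< n (λ i → f i + g i) ≡ Σ< n f + Σ< n g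
Σ-+ zero    f g = refl
Σ-+ (suc n) f g = trans (cong (_+ (f n + g n)) (Σ-+ n f g)) (eq (Σ< n f) (Σ< n g) (f n) (g n))
  where
  eq : ∀ a b c d → (a + b) + (c + d) ≡ (a + c) + (b + d)
  eq = solve-∀

Σ-*ˡ : ∀ n c f → Σ< n (λ i → c * f i) ≡ c * Σ< n f
Σ-*ˡ zero    c f = sym (ℤP.*-zeroʳ c)
Σ-*ˡ (suc n) c f =
  trans (cong (_+ c * f n) (Σ-*ˡ n c f)) (sym (ℤP.*-distribˡ-+ c (Σ< n f) (f n)))

Σ-front : ∀ n f → Σ< (suc n) f ≡ f 0 + Σ< n (λ i → f (suc i))
Σ-front zero    f = ℤP.+-comm (+ 0) (f 0)
Σ-front (suc n) f = trans (cong (_+ f (suc n)) (Σ-front n f)) (ℤP.+-assoc (f 0) _ _)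

Σ-append : ∀ m n f → Σ< (m ℕ.+ n) f ≡ Σ< m f + Σ< n (λ i → f (m ℕ.+ i))
Σ-append m zero    f = trans (cong (λ r → Σ< r f) (ℕP.+-identityʳ m)) (sym (ℤP.+-identityʳ _))
Σ-append m (suc n) f = begin
  Σ< (m ℕ.+ suc n) f                                       ≡⟨ cong (λ r → Σ< r f) (ℕP.+-suc m n) ⟩
  Σ< (m ℕ.+ n) f + f (m ℕ.+ n)                             ≡⟨ cong (_+ f (m ℕ.+ n)) (Σ-append m n f) ⟩
  Σ< m f + Σ< n (λ i → f (m ℕ.+ i)) + f (m ℕ.+ n)          ≡⟨ ℤP.+-assoc (Σ< m f) _ _ ⟩
  Σ< m f + Σ< (suc n) (λ i → f (m ℕ.+ i))                  ∎
  where open ≡-Reasoning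

Σ-swap : ∀ m n (f : ℕ → ℕ → ℤ) → Σ< m (λ i → Σ< n (f i)) ≡ Σ< n (λ j → Σ< m (λ i → f i j))
Σ-swap zero    n f = sym (Σ-zero n (λ _ _ → refl))
Σ-swap (suc m) n f = trans (cong (_+ Σ< n (f m)) (Σ-swap m n f)) (sym (Σ-+ n _ _))

-- Both sides run over the pairs n ≤ N < M, with d = N - n on the right. The induction on `M` splits
-- off the column n = 0.
Σ-triangle : ∀ M (f : ℕ → ℕ → ℤ) →
             Σ< M (λ N → Σ< (suc N) (f N)) ≡ Σ< M (λ n → Σ< (M ∸ n) (λ d → f (n ℕ.+ d) n))
Σ-triangle zero    f = refl
Σ-triangle (suc M) f = begin
  Σ< (suc M) (λ N → Σ< (suc N) (f N))
    ≡⟨ Σ-cong (suc M) (λ N _ → Σ-front N (f N)) ⟩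
  Σ< (suc M) (λ N → f N 0 + Σ< N (λ n → f N (suc n)))
    ≡⟨ Σ-+ (suc M) _ _ ⟩
  Σ< (suc M) (λ N → f N 0) + Σ< (suc M) (λ N → Σ< N (λ n → f N (suc n)))
    ≡⟨ cong (_+_ (Σ< (suc M) (λ N → f N 0))) (trans (Σ-front M _) (ℤP.+-identityˡ _)) ⟩
  Σ< (suc M) (λ N → f N 0) + Σ< M (λ N → Σ< (suc N) (λ n → f (suc N) (suc n)))
    ≡⟨ cong (_+_ (Σ< (suc M) (λ N → f N 0))) (Σ-triangle M (λ N n → f (suc N) (suc n))) ⟩
  Σ< (suc M) (λ N → f N 0) + Σ< M (λ n → Σ< (M ∸ n) (λ d → f (suc n ℕ.+ d) (suc n)))
    ≡⟨ Σ-front M _ ⟨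
  Σ< (suc M) (λ n → Σ< (suc M ∸ n) (λ d → f (n ℕ.+ d) n)) ∎
  where open ≡-Reasoning

Σ-nonneg : ∀ n {f} → (∀ i → + 0 ≤ f i) → + 0 ≤ Σ< n f
Σ-nonneg zero    h = ℤP.≤-refl
Σ-nonneg (suc n) h = ℤP.+-mono-≤ (Σ-nonneg n h) (h n)

Σ-mono : ∀ n {f g} → (∀ i → i ℕ.< n → f i ≤ g i) → Σ< n f ≤ Σ< n g
Σ-mono zero    h = ℤP.≤-refl
Σ-mono (suc n) h = ℤP.+-mono-≤ (Σ-mono n (λ i i<n → h i (ℕP.m<n⇒m<1+n i<n))) (h n ℕP.≤-refl)

Σ-extend : ∀ {m n f} → m ℕ.≤ n → (∀ i → + 0 ≤ f i) → Σ< m f ≤ Σ< n f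
Σ-extend {m} {n} {f} m≤n h = begin
  Σ< m f                                       ≡⟨ ℤP.+-identityʳ _ ⟨
  Σ< m f + + 0                                 ≤⟨ ℤP.+-monoʳ-≤ (Σ< m f) (Σ-nonneg (n ∸ m) (λ i → h (m ℕ.+ i))) ⟩
  Σ< m f + Σ< (n ∸ m) (λ i → f (m ℕ.+ i))      ≡⟨ Σ-append m (n ∸ m) f ⟨
  Σ< (m ℕ.+ (n ∸ m)) f                         ≡⟨ cong (λ r → Σ< r f) (ℕP.m+[n∸m]≡n m≤n) ⟩
  Σ< n f                                       ∎
  where open ℤP.≤-Reasoning

Σ-truncate : ∀ {m n f} → m ℕ.≤ n → (∀ i → m ℕ.≤ i → f i ≡ + 0) → Σ< n f ≡ Σ< m f
Σ-truncate {m} {n} {f} m≤n h = begin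
  Σ< n f                                       ≡⟨ cong (λ r → Σ< r f) (ℕP.m+[n∸m]≡n m≤n) ⟨
  Σ< (m ℕ.+ (n ∸ m)) f                         ≡⟨ Σ-append m (n ∸ m) f ⟩
  Σ< m f + Σ< (n ∸ m) (λ i → f (m ℕ.+ i))      ≡⟨ cong (_+_ (Σ< m f)) (Σ-zero (n ∸ m) (λ i _ → h _ (ℕP.m≤m+n m i))) ⟩
  Σ< m f + + 0                                 ≡⟨ ℤP.+-identityʳ _ ⟩
  Σ< m f                                       ∎
  where open ≡-Reasoning

-- The range is cut into blocks of length 2s and only the first half of each block is kept. This is
-- division with remainder in additive form: an index 2is + m with m < s determines i and m.
Σ-even-blocks : ∀ I s {f} → (∀ i → + 0 ≤ f i) →
                Σ< I (λ i → Σ< s (λ m → f (i ℕ.* (s ℕ.+ s) ℕ.+ m))) ≤ Σ< (I ℕ.* (s ℕ.+ s)) f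
Σ-even-blocks zero    s     h = ℤP.≤-refl
Σ-even-blocks (suc I) s {f} h = begin
  Σ< I (λ i → Σ< s (λ m → f (i ℕ.* (s ℕ.+ s) ℕ.+ m))) + Σ< s (λ m → f (b ℕ.+ m))
    ≤⟨ ℤP.+-mono-≤ (Σ-even-blocks I s h) (Σ-extend {s} {s ℕ.+ s} (ℕP.m≤m+n s s) (λ i → h (b ℕ.+ i))) ⟩
  Σ< b f + Σ< (s ℕ.+ s) (λ m → f (b ℕ.+ m))
    ≡⟨ Σ-append b (s ℕ.+ s) f ⟨
  Σ< (b ℕ.+ (s ℕ.+ s)) f
    ≡⟨ cong (λ r → Σ< r f) (ℕP.+-comm b (s ℕ.+ s)) ⟩
  Σ< (s ℕ.+ s ℕ.+ b) f ∎
  where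
  open ℤP.≤-Reasoning
  b = I ℕ.* (s ℕ.+ s)

-- The ring of formal power series

-- A record rather than a Π-type, so that both series can be inferred from an equation.
infix 4 _≈_
record _≈_ (f g : PS) : Set where
  constructor pointwise
  field at : ∀ k → f k ≡ g k
open _≈_

-- Splitting off the first or the last term of the convolution gives two recursions in the degree,
-- from which commutativity and associativity follow by induction.
⊛-suc-left : ∀ f g k → (f ⊛ g) (suc k) ≡ f 0 * g (suc k) + ((λ i → f (suc i)) ⊛ g) k
⊛-suc-left f g k = Σ-front (suc k) _

⊛-suc-right : ∀ f g k → (f ⊛ g) (suc k) ≡ (f ⊛ (λ i → g (suc i))) k + f (suc k) * g 0
⊛-suc-right f g k = cong₂ _+_
  (Σ-cong (suc k) λ { i (s≤s i≤k) → cong (λ r → f i * g r) (ℕP.+-∸-assoc 1 i≤k) })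
  (cong (λ r → f (suc k) * g r) (ℕP.n∸n≡0 k))

⊛-cong< : ∀ {f f′ g g′} k → (∀ i → i ℕ.≤ k → f i ≡ f′ i) → (∀ i → i ℕ.≤ k → g i ≡ g′ i) →
          (f ⊛ g) k ≡ (f′ ⊛ g′) k
⊛-cong< k p q = Σ-cong (suc k) λ { i (s≤s i≤k) → cong₂ _*_ (p i i≤k) (q (k ∸ i) (ℕP.m∸n≤m k i)) }

⊛-comm : ∀ k f g → (f ⊛ g) k ≡ (g ⊛ f) k
⊛-comm zero    f g = cong (_+_ (+ 0)) (ℤP.*-comm (f 0) (g 0))
⊛-comm (suc k) f g = begin
  (f ⊛ g) (suc k)                                       ≡⟨ ⊛-suc-left f g k ⟩
  f 0 * g (suc k) + ((λ i → f (suc i)) ⊛ g) k           ≡⟨ cong₂ _+_ (ℤP.*-comm (f 0) _) (⊛-comm k (λ i → f (suc i)) g) ⟩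
  g (suc k) * f 0 + (g ⊛ (λ i → f (suc i))) k           ≡⟨ ℤP.+-comm (g (suc k) * f 0) _ ⟩
  (g ⊛ (λ i → f (suc i))) k + g (suc k) * f 0           ≡⟨ ⊛-suc-right g f k ⟨
  (g ⊛ f) (suc k)                                       ∎
  where open ≡-Reasoning

⊛-distribʳ : ∀ k f g h → ((λ i → g i + h i) ⊛ f) k ≡ (g ⊛ f) k + (h ⊛ f) k
⊛-distribʳ k f g h =
  trans (Σ-cong (suc k) (λ i _ → ℤP.*-distribʳ-+ (f (k ∸ i)) (g i) (h i))) (Σ-+ (suc k) _ _)

⊛-scaleˡ : ∀ k c f g → ((λ i → c * f i) ⊛ g) k ≡ c * (f ⊛ g) k
⊛-scaleˡ k c f g =
  trans (Σ-cong (suc k) (λ i _ → ℤP.*-assoc c (f i) (g (k ∸ i)))) (Σ-*ˡ (suc k) c _)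

-- Induction on the degree for all series at once: the constant term of `f` is split off, and its
-- shifted tail falls under the induction hypothesis.
⊛-assoc : ∀ k f g h → ((f ⊛ g) ⊛ h) k ≡ (f ⊛ (g ⊛ h)) k
⊛-assoc zero    f g h = eq (f 0) (g 0) (h 0)
  where
  eq : ∀ a b c → + 0 + (+ 0 + a * b) * c ≡ + 0 + a * (+ 0 + b * c)
  eq = solve-∀
⊛-assoc (suc k) f g h = begin
  ((f ⊛ g) ⊛ h) (suc k)
    ≡⟨ ⊛-suc-left (f ⊛ g) h k ⟩
  (f ⊛ g) 0 * h (suc k) + ((λ i → (f ⊛ g) (suc i)) ⊛ h) k
    ≡⟨ cong (_+_ ((f ⊛ g) 0 * h (suc k)))
         (trans (⊛-cong< {g = h} k (λ i _ → ⊛-suc-left f g i) (λ _ _ → refl))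
         (trans (⊛-distribʳ k h (λ i → f 0 * g′ i) (f′ ⊛ g))
                (cong₂ _+_ (⊛-scaleˡ k (f 0) g′ h) (⊛-assoc k f′ g h)))) ⟩
  (f ⊛ g) 0 * h (suc k) + (f 0 * (g′ ⊛ h) k + (f′ ⊛ (g ⊛ h)) k)
    ≡⟨ eq (f 0) (g 0) _ _ _ ⟩
  f 0 * (g 0 * h (suc k) + (g′ ⊛ h) k) + (f′ ⊛ (g ⊛ h)) k
    ≡⟨ cong (λ r → f 0 * r + (f′ ⊛ (g ⊛ h)) k) (⊛-suc-left g h k) ⟨
  f 0 * (g ⊛ h) (suc k) + (f′ ⊛ (g ⊛ h)) k
    ≡⟨ ⊛-suc-left f (g ⊛ h) k ⟨
  (f ⊛ (g ⊛ h)) (suc k) ∎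
  where
  open ≡-Reasoning
  f′ g′ : PS
  f′ i = f (suc i)
  g′ i = g (suc i)
  eq : ∀ a b c d e → (+ 0 + a * b) * c + (a * d + e) ≡ a * (b * c + d) + e
  eq = solve-∀

-- Defined by cases on the degree so that both cases reduce; this embeds ℤ as the coefficient ring
-- of the solver.
constant : ℤ → PS
constant c zero    = c
constant c (suc _) = + 0

⊛-constantˡ : ∀ k c f → (constant c ⊛ f) k ≡ c * f k
⊛-constantˡ zero    c f = ℤP.+-identityˡ _
⊛-constantˡ (suc k) c f = trans (⊛-suc-left (constant c) f k)
  (trans (cong (_+_ (c * f (suc k))) (Σ-zero (suc k) (λ i _ → refl))) (ℤP.+-identityʳ _))

-- The operations are opaque so that equations between series are compared without unfolding sums.
infixl 7 _·_
infixl 6 _⊕_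
opaque
  _·_ _⊕_ : PS → PS → PS
  f · g = f ⊛ g
  (f ⊕ g) k = f k + g k

  ⊖_ : PS → PS
  (⊖ f) k = - f k

  const : ℤ → PS
  const = constant

opaque
  unfolding _·_ _⊕_ ⊖_ const

  -- The bridge between the `⊛` in which the theorem is stated and the opaque product.
  ·-⊛ : ∀ f g → f · g ≡ f ⊛ g
  ·-⊛ f g = refl

  ⊕-at : ∀ f g k → (f ⊕ g) k ≡ f k + g k
  ⊕-at f g k = refl

  const-0 : ∀ k → const (+ 0) k ≡ + 0
  const-0 zero    = refl
  const-0 (suc k) = refl

  const-1-nonneg : ∀ k → + 0 ≤ const (+ 1) k
  const-1-nonneg zero    = +≤+ z≤n
  const-1-nonneg (suc k) = ℤP.≤-refl

  isCommutativeRing : IsCommutativeRing _≈_ _⊕_ _·_ ⊖_ (const (+ 0)) (const (+ 1))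
  isCommutativeRing = record
    { isRing = record
      { +-isAbelianGroup = record
        { isGroup = record
          { isMonoid = record
            { isSemigroup = record
              { isMagma = record
                { isEquivalence = record
                  { refl  = pointwise λ k → refl
                  ; sym   = λ p → pointwise λ k → sym (at p k)
                  ; trans = λ p q → pointwise λ k → trans (at p k) (at q k) }
                ; ∙-cong = λ p q → pointwise λ k → cong₂ _+_ (at p k) (at q k) }
              ; assoc = λ f g h → pointwise λ k → ℤP.+-assoc (f k) (g k) (h k) }
            ; identity = (λ f → pointwise λ k → trans (cong (_+ f k) (const-0 k)) (ℤP.+-identityˡ (f k)))
                       , (λ f → pointwise λ k → trans (cong (_+_ (f k)) (const-0 k)) (ℤP.+-identityʳ (f k))) }
          ; inverse = (λ f → pointwise λ k → trans (ℤP.+-inverseˡ (f k)) (sym (const-0 k)))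
                    , (λ f → pointwise λ k → trans (ℤP.+-inverseʳ (f k)) (sym (const-0 k)))
          ; ⁻¹-cong = λ p → pointwise λ k → cong -_ (at p k) }
        ; comm = λ f g → pointwise λ k → ℤP.+-comm (f k) (g k) }
      ; *-cong = λ p q → pointwise λ k → ⊛-cong< k (λ i _ → at p i) (λ i _ → at q i)
      ; *-assoc = λ f g h → pointwise λ k → ⊛-assoc k f g h
      ; *-identity = (λ f → pointwise λ k → trans (⊛-constantˡ k (+ 1) f) (ℤP.*-identityˡ (f k)))
                   , (λ f → pointwise λ k → trans (⊛-comm k f (constant (+ 1)))
                                           (trans (⊛-constantˡ k (+ 1) f) (ℤP.*-identityˡ (f k))))
      ; distrib = (λ f g h → pointwise λ k → trans (⊛-comm k f (λ i → g i + h i))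
                              (trans (⊛-distribʳ k f g h) (cong₂ _+_ (⊛-comm k g f) (⊛-comm k h f))))
                , (λ f g h → pointwise λ k → ⊛-distribʳ k f g h) }
    ; *-comm = λ f g → pointwise λ k → ⊛-comm k f g }

PS-ring : CommutativeRing 0ℓ 0ℓ
PS-ring = record { isCommutativeRing = isCommutativeRing }

open CommutativeRing PS-ring
  using (setoid)
  renaming (refl to ≈-refl; sym to ≈-sym; trans to ≈-trans; +-cong to ⊕-cong; *-cong to ·-cong;
            +-identityˡ to ⊕-identityˡ; +-identityʳ to ⊕-identityʳ; *-comm to ·-comm; *-assoc to ·-assoc;
            *-identityˡ to ·-identityˡ; *-identityʳ to ·-identityʳ; -‿cong to ⊖-cong; distribˡ to ·-distribˡ; zeroʳ to ·-zeroʳ)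

opaque
  unfolding _·_ _⊕_ ⊖_ const

  const-+ : ∀ c d → const (c + d) ≈ const c ⊕ const d
  const-+ c d = pointwise λ { zero → refl ; (suc k) → refl }

  const-* : ∀ c d → const (c * d) ≈ const c · const d
  const-* c d = pointwise λ
    { zero → sym (⊛-constantˡ 0 c (constant d))
    ; (suc k) → sym (trans (⊛-constantˡ (suc k) c (constant d)) (ℤP.*-zeroʳ c)) }

  const-neg : ∀ c → const (- c) ≈ ⊖ const c
  const-neg c = pointwise λ { zero → refl ; (suc k) → refl }

  ⊖-at : ∀ f k → (⊖ f) k ≡ - f k
  ⊖-at f k = refl

  const-·-at : ∀ c f k → (const c · f) k ≡ c * f k
  const-·-at c f k = ⊛-constantˡ k c f

  -- Locality of the product: in degree `k` an infinite sum may be replaced by any truncation that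
  -- is correct up to `k`.
  ·-cong≤ : ∀ {f f′ g g′} k → (∀ i → i ℕ.≤ k → f i ≡ f′ i) → (∀ i → i ℕ.≤ k → g i ≡ g′ i) →
            (f · g) k ≡ (f′ · g′) k
  ·-cong≤ = ⊛-cong<

  const-1 : const (+ 1) ≈ one
  const-1 = pointwise λ { zero → refl ; (suc k) → refl }

-- Lets the ring solver compute with integer constants, so that signs and cancellations in ℤ[[q]]
-- are decided automatically.
const-homomorphism : CommutativeRing.rawRing ℤP.+-*-commutativeRing
                     -Raw-AlmostCommutative⟶ fromCommutativeRing PS-ring
const-homomorphism = record
  { ⟦_⟧    = const
  ; +-homo = const-+
  ; *-homo = const-*
  ; -‿homo = const-neg
  ; 0-homo = ≈-refl
  ; 1-homo = ≈-refl }

≡⇒≈ : ∀ {f g} → f ≡ g → f ≈ g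
≡⇒≈ refl = ≈-refl

const-≟ : ∀ c d → Maybe (const c ≈ const d)
const-≟ c d = Maybe.map (λ c≡d → ≡⇒≈ (cong const c≡d)) (dec⇒maybe (c ℤP.≟ d))

open Algebra.Solver.Ring _ _ const-homomorphism const-≟
  using (solve; _:=_; _:+_; _:*_; _:-_; :-_; con)


-- Monomials and geometric series

mono-≡ : ∀ d → mono d d ≡ + 1
mono-≡ d with d ℕ.≟ d
... | yes _ = refl
... | no ¬p = ⊥-elim (¬p refl)

mono-≢ : ∀ {d k} → k ≢ d → mono d k ≡ + 0
mono-≢ {d} {k} k≢d with k ℕ.≟ d
... | yes p = ⊥-elim (k≢d p)
... | no _  = refl

mono-suc : ∀ d k → mono (suc d) (suc k) ≡ mono d k
mono-suc d k with k ℕ.≟ d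
... | yes refl = mono-≡ (suc d)
... | no k≢d   = mono-≢ (λ p → k≢d (ℕP.suc-injective p))

mono-shift : ∀ e d k → mono (e ℕ.+ d) (e ℕ.+ k) ≡ mono d k
mono-shift zero    d k = refl
mono-shift (suc e) d k = trans (mono-suc (e ℕ.+ d) (e ℕ.+ k)) (mono-shift e d k)

mono-nonneg : ∀ d k → + 0 ≤ mono d k
mono-nonneg d k with k ℕ.≟ d
... | yes _ = +≤+ z≤n
... | no _  = ℤP.≤-refl

opaque
  unfolding _·_ _⊕_ const

  mono-·-suc : ∀ d f k → (mono (suc d) · f) (suc k) ≡ (mono d · f) k
  mono-·-suc d f k = trans (⊛-suc-left (mono (suc d)) f k)
    (trans (ℤP.+-identityˡ _) (⊛-cong< {g = f} k (λ i _ → mono-suc d i) (λ _ _ → refl)))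

  mono-0-· : ∀ f k → (mono 0 · f) k ≡ f k
  mono-0-· f k = trans (⊛-cong< {g = f} k (λ i _ → sym (at const-1 i)) (λ _ _ → refl))
                       (at (·-identityˡ f) k)

  mono-·-zero : ∀ d f → (mono (suc d) · f) 0 ≡ + 0
  mono-·-zero d f = refl

  mono-·-mono-≤ : ∀ d {f g} → (∀ k → f k ≤ g k) → ∀ k → (mono d · f) k ≤ (mono d · g) k
  mono-·-mono-≤ d {f} {g} h k = Σ-mono (suc k)
    (λ i _ → ℤP.*-monoˡ-≤-nonNeg (mono d i) {{ℤ.nonNegative (mono-nonneg d i)}} (h (k ∸ i)))

mono-·-< : ∀ d f k → k ℕ.< d → (mono d · f) k ≡ + 0
mono-·-< (suc d) f zero    _         = mono-·-zero d f
mono-·-< (suc d) f (suc k) (s≤s k<d) = trans (mono-·-suc d f k) (mono-·-< d f k k<d)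

mono-·-+ : ∀ d f k → (mono d · f) (d ℕ.+ k) ≡ f k
mono-·-+ zero    f k = mono-0-· f k
mono-·-+ (suc d) f k = trans (mono-·-suc d f (d ℕ.+ k)) (mono-·-+ d f k)

mono-·-nonneg : ∀ d {f} → (∀ k → + 0 ≤ f k) → ∀ k → + 0 ≤ (mono d · f) k
mono-·-nonneg d {f} h k = ℤP.≤-trans
  (ℤP.≤-reflexive (sym (trans (at (·-zeroʳ (mono d)) k) (const-0 k))))
  (mono-·-mono-≤ d (λ i → ℤP.≤-trans (ℤP.≤-reflexive (const-0 i)) (h i)) k)

mono-+ : ∀ d e → mono (d ℕ.+ e) ≈ mono d · mono e
mono-+ d e = pointwise λ k → lemma d k
  where
  lemma : ∀ d k → mono (d ℕ.+ e) k ≡ (mono d · mono e) k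
  lemma zero    k       = sym (mono-0-· (mono e) k)
  lemma (suc d) zero    = sym (mono-·-zero d (mono e))
  lemma (suc d) (suc k) = trans (mono-suc (d ℕ.+ e) k) (trans (lemma d k) (sym (mono-·-suc d (mono e) k)))

-- G = 1 + c q^(m+1) G: the term j = 0 is the 1, and the others carry a common factor c q^(m+1).
-- Both inverse laws below follow from this equation alone.
geomInv-unfold : ∀ c m → geomInv c m ≈ const (+ 1) ⊕ const c · (mono (suc m) · geomInv c m)
geomInv-unfold c m = pointwise λ k → begin
  geomInv c m k
    ≡⟨ Σ-front k _ ⟩
  mono 0 k * + 1 + Σ< k (λ j → mono (suc m ℕ.+ j ℕ.* suc m) k * (c * c ^ j))
    ≡⟨ cong₂ _+_ (trans (ℤP.*-identityʳ (mono 0 k)) (sym (at const-1 k))) (tail k) ⟩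
  const (+ 1) k + (const c · (mono (suc m) · geomInv c m)) k
    ≡⟨ ⊕-at _ _ k ⟨
  (const (+ 1) ⊕ const c · (mono (suc m) · geomInv c m)) k ∎
  where
  open ≡-Reasoning
  swap : ∀ a b d → a * (b * d) ≡ b * (a * d)
  swap = solve-∀
  j≤j*suc : ∀ j → j ℕ.≤ j ℕ.* suc m
  j≤j*suc j = ℕP.m≤m*n j (suc m)
  sum-shift : ∀ k → Σ< k (λ j → mono (suc m ℕ.+ j ℕ.* suc m) k * c ^ j) ≡ (mono (suc m) · geomInv c m) k
  sum-shift k with k ℕ.<? suc m
  ... | yes k<sm = trans
    (Σ-zero k (λ j _ → cong (_* c ^ j) (mono-≢ (ℕP.<⇒≢ (ℕP.<-≤-trans k<sm (ℕP.m≤m+n (suc m) _))))))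
    (sym (mono-·-< (suc m) _ k k<sm))
  ... | no k≮sm = subst
    (λ k → Σ< k (λ j → mono (suc m ℕ.+ j ℕ.* suc m) k * c ^ j) ≡ (mono (suc m) · geomInv c m) k)
    (ℕP.m+[n∸m]≡n (ℕP.≮⇒≥ k≮sm)) (shifted (k ∸ suc m))
    where
    shifted : ∀ r → Σ< (suc m ℕ.+ r) (λ j → mono (suc m ℕ.+ j ℕ.* suc m) (suc m ℕ.+ r) * c ^ j)
                    ≡ (mono (suc m) · geomInv c m) (suc m ℕ.+ r)
    shifted r = begin
      Σ< (suc m ℕ.+ r) (λ j → mono (suc m ℕ.+ j ℕ.* suc m) (suc m ℕ.+ r) * c ^ j)
        ≡⟨ Σ-cong (suc m ℕ.+ r) (λ j _ → cong (_* c ^ j) (mono-shift (suc m) _ r)) ⟩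
      Σ< (suc m ℕ.+ r) (λ j → mono (j ℕ.* suc m) r * c ^ j)
        -- The left sum has m + 1 + r terms and `geomInv` in degree r only r + 1; the surplus terms
        -- have j > r, hence exponent j(m+1) > r.
        ≡⟨ Σ-truncate (s≤s (ℕP.m≤n+m r m))
             (λ j r<j → cong (_* c ^ j) (mono-≢ (ℕP.<⇒≢ (ℕP.<-≤-trans r<j (j≤j*suc j))))) ⟩
      geomInv c m r
        ≡⟨ mono-·-+ (suc m) (geomInv c m) r ⟨
      (mono (suc m) · geomInv c m) (suc m ℕ.+ r) ∎
  tail : ∀ k → Σ< k (λ j → mono (suc m ℕ.+ j ℕ.* suc m) k * (c * c ^ j))
               ≡ (const c · (mono (suc m) · geomInv c m)) k
  tail k = begin
    Σ< k (λ j → mono (suc m ℕ.+ j ℕ.* suc m) k * (c * c ^ j))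
      ≡⟨ Σ-cong k (λ j _ → swap (mono (suc m ℕ.+ j ℕ.* suc m) k) c (c ^ j)) ⟩
    Σ< k (λ j → c * (mono (suc m ℕ.+ j ℕ.* suc m) k * c ^ j))
      ≡⟨ Σ-*ˡ k c _ ⟩
    c * Σ< k (λ j → mono (suc m ℕ.+ j ℕ.* suc m) k * c ^ j)
      ≡⟨ cong (c *_) (sum-shift k) ⟩
    c * (mono (suc m) · geomInv c m) k
      ≡⟨ const-·-at c _ k ⟨
    (const c · (mono (suc m) · geomInv c m)) k ∎

factor : ℕ → PS
factor m = const (+ 1) ⊕ ⊖ mono (suc m)

factor-·-geomInv : ∀ m → factor m · geomInv (+ 1) m ≈ const (+ 1)
factor-·-geomInv m = begin
  factor m · G
    ≈⟨ solve 2 (λ q g → (con (+ 1) :+ (:- q)) :* g := g :+ (:- (q :* g))) ≈-refl (mono (suc m)) G ⟩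
  G ⊕ ⊖ (mono (suc m) · G)
    ≈⟨ ⊕-cong (geomInv-unfold (+ 1) m) ≈-refl ⟩
  (const (+ 1) ⊕ const (+ 1) · (mono (suc m) · G)) ⊕ ⊖ (mono (suc m) · G)
    ≈⟨ solve 1 (λ x → (con (+ 1) :+ con (+ 1) :* x) :+ (:- x) := con (+ 1)) ≈-refl (mono (suc m) · G) ⟩
  const (+ 1) ∎
  where
  open SetoidReasoning setoid
  G = geomInv (+ 1) m

1+mono-·-geomInv : ∀ m → (const (+ 1) ⊕ mono (suc m)) · geomInv (- (+ 1)) m ≈ const (+ 1)
1+mono-·-geomInv m = begin
  (const (+ 1) ⊕ mono (suc m)) · G
    ≈⟨ solve 2 (λ q g → (con (+ 1) :+ q) :* g := g :+ q :* g) ≈-refl (mono (suc m)) G ⟩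
  G ⊕ mono (suc m) · G
    ≈⟨ ⊕-cong (geomInv-unfold (- (+ 1)) m) ≈-refl ⟩
  (const (+ 1) ⊕ const (- (+ 1)) · (mono (suc m) · G)) ⊕ mono (suc m) · G
    ≈⟨ solve 1 (λ x → (con (+ 1) :+ con (- (+ 1)) :* x) :+ x := con (+ 1)) ≈-refl (mono (suc m) · G) ⟩
  const (+ 1) ∎
  where
  open SetoidReasoning setoid
  G = geomInv (- (+ 1)) m

-- Finite sums and products of series

∑ : ℕ → (ℕ → PS) → PS
∑ zero    f = const (+ 0)
∑ (suc n) f = ∑ n f ⊕ f n

∑-at : ∀ n f k → ∑ n f k ≡ Σ< n (λ i → f i k)
∑-at zero    f k = const-0 k
∑-at (suc n) f k = trans (⊕-at _ _ k) (cong (_+ f n k) (∑-at n f k))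

∑-·ˡ : ∀ n g f → g · ∑ n f ≈ ∑ n (λ i → g · f i)
∑-·ˡ zero    g f = ·-zeroʳ g
∑-·ˡ (suc n) g f = ≈-trans (·-distribˡ g (∑ n f) (f n)) (⊕-cong (∑-·ˡ n g f) ≈-refl)

∏ : ℕ → (ℕ → PS) → PS
∏ zero    f = const (+ 1)
∏ (suc n) f = ∏ n f · f n

∏<≈∏ : ∀ n f → ∏< n f ≈ ∏ n f
∏<≈∏ zero    f = ≈-sym const-1
∏<≈∏ (suc n) f = ≈-trans (≡⇒≈ (sym (·-⊛ (∏< n f) (f n)))) (·-cong (∏<≈∏ n f) ≈-refl)

∏-cong : ∀ n {f g} → (∀ i → f i ≡ g i) → ∏ n f ≈ ∏ n g
∏-cong zero    h = ≈-refl
∏-cong (suc n) h = ·-cong (∏-cong n h) (≡⇒≈ (h n))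

∏-front : ∀ n f → ∏ (suc n) f ≈ f 0 · ∏ n (λ i → f (suc i))
∏-front zero    f = ·-comm (const (+ 1)) (f 0)
∏-front (suc n) f = ≈-trans (·-cong (∏-front n f) ≈-refl) (·-assoc (f 0) _ _)

-- Reciprocals of q-Pochhammer symbols

-- 1 / (q^(m+1); q)_r
invFrom : ℕ → ℕ → PS
invFrom m r = ∏ r (λ i → geomInv (+ 1) (m ℕ.+ i))

invFrom-front : ∀ m r → invFrom m (suc r) ≈ geomInv (+ 1) m · invFrom (suc m) r
invFrom-front m r = ≈-trans (∏-front r _)
  (·-cong (≡⇒≈ (cong (geomInv (+ 1)) (ℕP.+-identityʳ m)))
          (∏-cong r (λ i → cong (geomInv (+ 1)) (ℕP.+-suc m i))))

factor-·-invFrom-front : ∀ m r → factor m · invFrom m (suc r) ≈ invFrom (suc m) r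
factor-·-invFrom-front m r = begin
  factor m · invFrom m (suc r)                          ≈⟨ ·-cong ≈-refl (invFrom-front m r) ⟩
  factor m · (geomInv (+ 1) m · invFrom (suc m) r)      ≈⟨ ·-assoc _ _ _ ⟨
  factor m · geomInv (+ 1) m · invFrom (suc m) r        ≈⟨ ·-cong (factor-·-geomInv m) ≈-refl ⟩
  const (+ 1) · invFrom (suc m) r                       ≈⟨ ·-identityˡ _ ⟩
  invFrom (suc m) r                                     ∎
  where open SetoidReasoning setoid

factor-·-invFrom-back : ∀ m r → factor (m ℕ.+ r) · invFrom m (suc r) ≈ invFrom m r
factor-·-invFrom-back m r = begin
  factor (m ℕ.+ r) · (invFrom m r · geomInv (+ 1) (m ℕ.+ r))
    ≈⟨ solve 3 (λ f i g → f :* (i :* g) := i :* (f :* g)) ≈-refl _ _ _ ⟩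
  invFrom m r · (factor (m ℕ.+ r) · geomInv (+ 1) (m ℕ.+ r))
    ≈⟨ ·-cong ≈-refl (factor-·-geomInv (m ℕ.+ r)) ⟩
  invFrom m r · const (+ 1)
    ≈⟨ ·-identityʳ _ ⟩
  invFrom m r ∎
  where open SetoidReasoning setoid

-- Triangular exponents and the ratio of q^(n(n+1)/2) to (-q; q)_n

tri : ℕ → ℕ
tri n = (n ℕ.* suc n) ℕ./ 2

-- (n+1)(n+2) = 2(n+1) + n(n+1), and truncating division by 2 distributes over this sum because its
-- first summand is even.
tri-suc : ∀ n → tri (suc n) ≡ suc n ℕ.+ tri n
tri-suc n = begin
  (suc n ℕ.* suc (suc n)) ℕ./ 2             ≡⟨ cong (ℕ._/ 2) (eq n) ⟩
  (suc n ℕ.* 2 ℕ.+ n ℕ.* suc n) ℕ./ 2       ≡⟨ +-distrib-/-∣ˡ (n ℕ.* suc n) (divides-refl (suc n)) ⟩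
  (suc n ℕ.* 2) ℕ./ 2 ℕ.+ tri n             ≡⟨ cong (ℕ._+ tri n) (m*n/n≡m (suc n) 2) ⟩
  suc n ℕ.+ tri n                           ∎
  where
  open ≡-Reasoning
  eq : ∀ n → suc n ℕ.* suc (suc n) ≡ suc n ℕ.* 2 ℕ.+ n ℕ.* suc n
  eq = ℕSolver.solve-∀

-- q^(n(n+1)/2) / (-q; q)_n
t : ℕ → PS
t n = mono (tri n) · ∏ n (geomInv (- (+ 1)))

-- The factor 1 + q^(n+1) cancels the last factor of (-q; q)_(n+1), and the triangular exponent
-- drops by n + 1.
t-suc : ∀ n → (const (+ 1) ⊕ mono (suc n)) · t (suc n) ≈ mono (suc n) · t n
t-suc n = begin
  P · (mono (tri (suc n)) · (N · G))
    ≈⟨ ·-cong ≈-refl (·-cong (≈-trans (≡⇒≈ (cong mono (tri-suc n))) (mono-+ (suc n) (tri n))) ≈-refl) ⟩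
  P · (mono (suc n) · mono (tri n) · (N · G))
    ≈⟨ solve 5 (λ p a b c g → p :* (a :* b :* (c :* g)) := (p :* g) :* (a :* (b :* c))) ≈-refl
         P (mono (suc n)) (mono (tri n)) N G ⟩
  (P · G) · (mono (suc n) · t n)
    ≈⟨ ·-cong (1+mono-·-geomInv n) ≈-refl ⟩
  const (+ 1) · (mono (suc n) · t n)
    ≈⟨ ·-identityˡ _ ⟩
  mono (suc n) · t n ∎
  where
  open SetoidReasoning setoid
  P = const (+ 1) ⊕ mono (suc n)
  N = ∏ n (geomInv (- (+ 1)))
  G = geomInv (- (+ 1)) n

-- Telescoping the series into an alternating sum

module Telescoping (L : ℕ) where

  -- This is (q^(L+1); q)_j.
  poch : ℕ → PS
  poch j = ∏ j (λ i → factor (L ℕ.+ i))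

  -- In w, u, v and g the index j stands for n = j + 1.
  w : ℕ → ℕ → PS
  w m j = poch j · (mono (m ℕ.* suc j) · t (suc j))

  u : ℕ → ℕ → PS
  u m j = w m j · invFrom m (suc (L ℕ.+ j))

  v : ℕ → ℕ → PS
  v m j = w m j · invFrom m (suc (suc (L ℕ.+ j)))

  g : ℕ → ℕ → PS
  g m j = (const (+ 1) ⊕ mono (suc j)) · u m j

  -- `v m j` carries (q^(m+1); q)_(L+j+2), a common denominator of `u m j`, `u (suc m) j` and
  -- `g m (suc j)`. This lemma and the next two write each of them as a polynomial times `v m j`,
  -- which reduces telescoping to a polynomial identity.
  u≈v : ∀ m j → u m j ≈ factor (m ℕ.+ suc (L ℕ.+ j)) · v m j
  u≈v m j = begin
    w m j · invFrom m r                                       ≈⟨ ·-cong ≈-refl (factor-·-invFrom-back m r) ⟨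
    w m j · (factor (m ℕ.+ r) · invFrom m (suc r))            ≈⟨ solve 3 (λ a b c → a :* (b :* c) := b :* (a :* c)) ≈-refl _ _ _ ⟩
    factor (m ℕ.+ r) · v m j ∎
    where
    open SetoidReasoning setoid
    r = suc (L ℕ.+ j)

  u-suc≈v : ∀ m j → u (suc m) j ≈ mono (suc j) · factor m · v m j
  u-suc≈v m j = begin
    poch j · (mono (suc j ℕ.+ m ℕ.* suc j) · t (suc j)) · invFrom (suc m) r
      ≈⟨ ·-cong (·-cong ≈-refl (·-cong (mono-+ (suc j) (m ℕ.* suc j)) ≈-refl)) (≈-sym (factor-·-invFrom-front m r)) ⟩
    poch j · (mono (suc j) · mono (m ℕ.* suc j) · t (suc j)) · (factor m · invFrom m (suc r))
      ≈⟨ solve 6 (λ a b c d e f → a :* (b :* c :* d) :* (e :* f) := b :* e :* (a :* (c :* d) :* f)) ≈-refl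
           (poch j) (mono (suc j)) (mono (m ℕ.* suc j)) (t (suc j)) (factor m) (invFrom m (suc r)) ⟩
    mono (suc j) · factor m · v m j ∎
    where
    open SetoidReasoning setoid
    r = suc (L ℕ.+ j)

  -- The factor 1 + q^(n+1) in `g` is absorbed by `t-suc`, which brings t_(n+1) back to t_n; the new
  -- factor of `poch` remains.
  g-suc≈v : ∀ m j → g m (suc j) ≈ mono (suc m) · mono (suc j) · factor (L ℕ.+ j) · v m j
  g-suc≈v m j = begin
    P · (poch j · F · (mono (m ℕ.* suc (suc j)) · t (suc (suc j))) · invFrom m (suc (L ℕ.+ suc j)))
      ≈⟨ ·-cong ≈-refl (·-cong (·-cong ≈-refl (·-cong mono-split ≈-refl))
           (≡⇒≈ (cong (λ r → invFrom m (suc r)) (ℕP.+-suc L j)))) ⟩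
    P · (poch j · F · (mono m · B · t (suc (suc j))) · I)
      ≈⟨ solve 7 (λ p a f c b t i → p :* (a :* f :* (c :* b :* t) :* i) := (p :* t) :* (a :* f :* (c :* b) :* i)) ≈-refl
           P (poch j) F (mono m) B (t (suc (suc j))) I ⟩
    (P · t (suc (suc j))) · (poch j · F · (mono m · B) · I)
      ≈⟨ ·-cong (t-suc (suc j)) ≈-refl ⟩
    (mono (suc (suc j)) · t (suc j)) · (poch j · F · (mono m · B) · I)
      ≈⟨ solve 7 (λ x a f c b t i → (x :* t) :* (a :* f :* (c :* b) :* i) := (c :* x) :* f :* (a :* (b :* t) :* i)) ≈-refl
           (mono (suc (suc j))) (poch j) F (mono m) B (t (suc j)) I ⟩
    mono m · mono (suc (suc j)) · F · v m j
      ≈⟨ ·-cong (·-cong mono-regroup ≈-refl) ≈-refl ⟩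
    mono (suc m) · mono (suc j) · F · v m j ∎
    where
    open SetoidReasoning setoid
    P = const (+ 1) ⊕ mono (suc (suc j))
    F = factor (L ℕ.+ j)
    B = mono (m ℕ.* suc j)
    I = invFrom m (suc (suc (L ℕ.+ j)))
    mono-split : mono (m ℕ.* suc (suc j)) ≈ mono m · B
    mono-split = ≈-trans (≡⇒≈ (cong mono (ℕP.*-suc m (suc j)))) (mono-+ m (m ℕ.* suc j))
    mono-regroup : mono m · mono (suc (suc j)) ≈ mono (suc m) · mono (suc j)
    mono-regroup = ≈-trans (≈-sym (mono-+ m (suc (suc j))))
      (≈-trans (≡⇒≈ (cong mono (ℕP.+-suc m (suc j)))) (mono-+ (suc m) (suc j)))

  -- With X = q^(j+1), Y = q^(m+1), Z = q^L it is the identity (1 - XYZ) + X(1 - Y) + XY(1 - XZ) =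
  -- (1 + X)(1 - XYZ), multiplied by `v m j`.
  g-telescopes : ∀ m j → u m j ⊕ u (suc m) j ⊕ g m (suc j) ≈ g m j
  g-telescopes m j = begin
    u m j ⊕ u (suc m) j ⊕ g m (suc j)
      ≈⟨ ⊕-cong (⊕-cong u≈ (u-suc≈v m j)) g-suc≈ ⟩
    (const (+ 1) ⊕ ⊖ (X · Y · Z)) · V ⊕ X · factor m · V ⊕ Y · X · (const (+ 1) ⊕ ⊖ (Z · X)) · V
      ≈⟨ solve 4 (λ x y z c →
           (con (+ 1) :+ (:- (x :* y :* z))) :* c :+ x :* (con (+ 1) :+ (:- y)) :* c
             :+ y :* x :* (con (+ 1) :+ (:- (z :* x))) :* c
           := (con (+ 1) :+ x) :* ((con (+ 1) :+ (:- (x :* y :* z))) :* c)) ≈-refl X Y Z V ⟩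
    (const (+ 1) ⊕ X) · ((const (+ 1) ⊕ ⊖ (X · Y · Z)) · V)
      ≈⟨ ·-cong ≈-refl u≈ ⟨
    g m j ∎
    where
    open SetoidReasoning setoid
    X = mono (suc j)
    Y = mono (suc m)
    Z = mono L
    V = v m j
    XYZ : mono (suc (m ℕ.+ suc (L ℕ.+ j))) ≈ X · Y · Z
    XYZ = ≈-trans (≡⇒≈ (cong mono (eq m L j)))
      (≈-trans (mono-+ (suc j ℕ.+ suc m) L) (·-cong (mono-+ (suc j) (suc m)) ≈-refl))
      where
      eq : ∀ m L j → suc (m ℕ.+ suc (L ℕ.+ j)) ≡ suc j ℕ.+ suc m ℕ.+ L
      eq = ℕSolver.solve-∀
    ZX : mono (suc (L ℕ.+ j)) ≈ Z · X
    ZX = ≈-trans (≡⇒≈ (cong mono (sym (ℕP.+-suc L j)))) (mono-+ L (suc j))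
    u≈ : u m j ≈ (const (+ 1) ⊕ ⊖ (X · Y · Z)) · V
    u≈ = ≈-trans (u≈v m j) (·-cong (⊕-cong ≈-refl (⊖-cong XYZ)) ≈-refl)
    g-suc≈ : g m (suc j) ≈ Y · X · (const (+ 1) ⊕ ⊖ (Z · X)) · V
    g-suc≈ = ≈-trans (g-suc≈v m j) (·-cong (·-cong ≈-refl (⊕-cong ≈-refl (⊖-cong ZX))) ≈-refl)

  ∑u-telescopes : ∀ K m → ∑ K (u m) ⊕ ∑ K (u (suc m)) ⊕ g m K ≈ g m 0
  ∑u-telescopes zero    m =
    solve 1 (λ x → con (+ 0) :+ con (+ 0) :+ x := x) ≈-refl (g m 0)
  ∑u-telescopes (suc K) m = begin
    (∑ K (u m) ⊕ u m K) ⊕ (∑ K (u (suc m)) ⊕ u (suc m) K) ⊕ g m (suc K)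
      ≈⟨ solve 5 (λ a b c d e → (a :+ b) :+ (c :+ d) :+ e := a :+ c :+ (b :+ d :+ e)) ≈-refl _ _ _ _ _ ⟩
    ∑ K (u m) ⊕ ∑ K (u (suc m)) ⊕ (u m K ⊕ u (suc m) K ⊕ g m (suc K))
      ≈⟨ ⊕-cong ≈-refl (g-telescopes m K) ⟩
    ∑ K (u m) ⊕ ∑ K (u (suc m)) ⊕ g m K
      ≈⟨ ∑u-telescopes K m ⟩
    g m 0 ∎
    where open SetoidReasoning setoid

  -- Generating function of the partitions with smallest part m + 1 and largest part at most m + 1 + L.
  A : ℕ → PS
  A m = mono (suc m) · invFrom m (suc L)

  -- For n = 1 the factor 1 + q cancels (-q; q)_1 and leaves q · q^m. The indices are shifted: `A m`
  -- is A_(m+1) of the overview, so `A 0` is the dominating series.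
  g-0 : ∀ m → g m 0 ≈ A m
  g-0 m = begin
    P · (const (+ 1) · (mono (m ℕ.* 1) · t 1) · invFrom m (suc (L ℕ.+ 0)))
      ≈⟨ ·-cong ≈-refl (·-cong (·-cong ≈-refl (·-cong (≡⇒≈ (cong mono (ℕP.*-identityʳ m))) ≈-refl))
           (≡⇒≈ (cong (λ r → invFrom m (suc r)) (ℕP.+-identityʳ L)))) ⟩
    P · (const (+ 1) · (mono m · t 1) · I)
      ≈⟨ solve 4 (λ p a t i → p :* (con (+ 1) :* (a :* t) :* i) := (p :* t) :* a :* i) ≈-refl P (mono m) (t 1) I ⟩
    P · t 1 · mono m · I
      ≈⟨ ·-cong (·-cong (t-suc 0) ≈-refl) ≈-refl ⟩
    mono 1 · (mono 0 · const (+ 1)) · mono m · I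
      ≈⟨ ·-cong (·-cong (·-cong ≈-refl (·-cong (≈-sym const-1) ≈-refl)) ≈-refl) ≈-refl ⟩
    mono 1 · (const (+ 1) · const (+ 1)) · mono m · I
      ≈⟨ solve 3 (λ q a i → q :* (con (+ 1) :* con (+ 1)) :* a :* i := q :* a :* i) ≈-refl (mono 1) (mono m) I ⟩
    mono 1 · mono m · I
      ≈⟨ ·-cong (mono-+ 1 m) ≈-refl ⟨
    A m ∎
    where
    open SetoidReasoning setoid
    P = const (+ 1) ⊕ mono 1
    I = invFrom m (suc L)

  -- With n = j + 1, the exponent mn + n(n+1)/2 is (m+1)n plus a triangular number. The bound grows
  -- with both indices, so it makes the sum over n finite in each degree and kills the remainder for
  -- large m.
  u-order : ∀ m j k → k ℕ.< suc m ℕ.* suc j → u m j k ≡ + 0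
  u-order m j k k< = trans (at u-factored k) (mono-·-< (suc m ℕ.* suc j) _ k k<)
    where
    open SetoidReasoning setoid
    N = ∏ (suc j) (geomInv (- (+ 1)))
    I = invFrom m (suc (L ℕ.+ j))
    u-factored : u m j ≈ mono (suc m ℕ.* suc j) · (mono (tri j) · N · poch j · I)
    u-factored = begin
      poch j · (mono (m ℕ.* suc j) · (mono (tri (suc j)) · N)) · I
        ≈⟨ ·-cong (·-cong ≈-refl (·-cong ≈-refl (·-cong
             (≈-trans (≡⇒≈ (cong mono (tri-suc j))) (mono-+ (suc j) (tri j))) ≈-refl))) ≈-refl ⟩
      poch j · (mono (m ℕ.* suc j) · (mono (suc j) · mono (tri j) · N)) · I
        ≈⟨ solve 6 (λ p a b c n i → p :* (a :* (b :* c :* n)) :* i := b :* a :* (c :* n :* p :* i)) ≈-refl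
             (poch j) (mono (m ℕ.* suc j)) (mono (suc j)) (mono (tri j)) N I ⟩
      mono (suc j) · mono (m ℕ.* suc j) · (mono (tri j) · N · poch j · I)
        ≈⟨ ·-cong (mono-+ (suc j) (m ℕ.* suc j)) ≈-refl ⟨
      mono (suc m ℕ.* suc j) · (mono (tri j) · N · poch j · I) ∎

  -- The coefficient of q^k in the sum of `u m j` over all j: by `u-order` the terms with j ≥ k
  -- contribute nothing, so `suc k` terms suffice.
  U : ℕ → ℕ → ℤ
  U m k = ∑ (suc k) (u m) k

  -- Telescoping over `suc k` terms leaves the boundary term `g m (suc k)`, which is divisible by a
  -- power of q beyond q^k.
  U-step : ∀ m k → U m k ≡ A m k + - U (suc m) k
  U-step m k = begin
    U m k
      ≡⟨ eq (U m k) (U (suc m) k) ⟩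
    (U m k + U (suc m) k + + 0) + - U (suc m) k
      ≡⟨ cong (λ r → (U m k + U (suc m) k + r) + - U (suc m) k) g-vanishes ⟨
    (U m k + U (suc m) k + g m (suc k) k) + - U (suc m) k
      ≡⟨ cong (_+ - U (suc m) k) telescoped ⟩
    A m k + - U (suc m) k ∎
    where
    open ≡-Reasoning
    eq : ∀ a b → a ≡ (a + b + + 0) + - b
    eq = solve-∀
    telescoped : U m k + U (suc m) k + g m (suc k) k ≡ A m k
    telescoped = trans (sym (trans (⊕-at _ _ k) (cong (_+ g m (suc k) k) (⊕-at _ _ k))))
      (at (≈-trans (∑u-telescopes (suc k) m) (g-0 m)) k)
    k< : ∀ i → i ℕ.≤ k → i ℕ.< suc m ℕ.* suc (suc k)
    k< i i≤k = ℕP.<-≤-trans (s≤s (ℕP.m≤n⇒m≤1+n i≤k)) (ℕP.m≤m+n (suc (suc k)) _)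
    g-vanishes : g m (suc k) k ≡ + 0
    g-vanishes = trans
      (·-cong≤ {g′ = const (+ 0)} k (λ _ _ → refl)
        (λ i i≤k → trans (u-order m (suc k) i (k< i i≤k)) (sym (const-0 i))))
      (trans (at (·-zeroʳ _) k) (const-0 k))

  U-order : ∀ m k → k ℕ.≤ m → U m k ≡ + 0
  U-order m k k≤m = trans (∑-at (suc k) (u m) k)
    (Σ-zero (suc k) (λ j _ → u-order m j k (ℕP.<-≤-trans (s≤s k≤m) (ℕP.m≤m*n (suc m) (suc j)))))

  -- Each round applies `U-step` twice, at 2I and at 2I + 1; the remainder keeps a plus sign.
  U-alternating : ∀ I k → U 0 k ≡ Σ< I (λ i → A (i ℕ.* 2) k) + - Σ< I (λ i → A (suc (i ℕ.* 2)) k) + U (I ℕ.* 2) k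
  U-alternating zero    k = sym (ℤP.+-identityˡ _)
  U-alternating (suc I) k = trans (U-alternating I k)
    (trans (cong (_+_ (E + - O)) (trans (U-step (I ℕ.* 2) k) (cong (λ r → A (I ℕ.* 2) k + - r) (U-step (suc (I ℕ.* 2)) k))))
           (eq E O (A (I ℕ.* 2) k) (A (suc (I ℕ.* 2)) k) (U (suc I ℕ.* 2) k)))
    where
    E = Σ< I (λ i → A (i ℕ.* 2) k)
    O = Σ< I (λ i → A (suc (i ℕ.* 2)) k)
    eq : ∀ e o a b r → e + - o + (a + - (b + - r)) ≡ (e + a) + - (o + b) + r
    eq = solve-∀

  -- Identification of the given series with `U 0`

  poch-·-invFrom : ∀ j → poch j · invFrom 0 (L ℕ.+ j) ≈ invFrom 0 L
  poch-·-invFrom zero    = ≈-trans (·-identityˡ _) (≡⇒≈ (cong (invFrom 0) (ℕP.+-identityʳ L)))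
  poch-·-invFrom (suc j) = begin
    poch j · F · invFrom 0 (L ℕ.+ suc j)            ≈⟨ ·-cong ≈-refl (≡⇒≈ (cong (invFrom 0) (ℕP.+-suc L j))) ⟩
    poch j · F · invFrom 0 (suc (L ℕ.+ j))          ≈⟨ ·-assoc _ _ _ ⟩
    poch j · (F · invFrom 0 (suc (L ℕ.+ j)))        ≈⟨ ·-cong ≈-refl (factor-·-invFrom-back 0 (L ℕ.+ j)) ⟩
    poch j · invFrom 0 (L ℕ.+ j)                    ≈⟨ poch-·-invFrom j ⟩
    invFrom 0 L                                     ∎
    where
    open SetoidReasoning setoid
    F = factor (L ℕ.+ j)

  summand≈ : ∀ j → summand L (suc j) ≈ t (suc j) · geomInv (+ 1) (L ℕ.+ j)
  summand≈ j = begin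
    mono (tri (suc j)) ⊛ invNegQPoch (suc j) ⊛ geomInv (+ 1) ((L ℕ.+ suc j) ∸ 1)
      ≈⟨ ≡⇒≈ (trans (sym (·-⊛ _ _)) (cong₂ _·_ (sym (·-⊛ _ _)) (cong (λ r → geomInv (+ 1) (r ∸ 1)) (ℕP.+-suc L j)))) ⟩
    mono (tri (suc j)) · invNegQPoch (suc j) · geomInv (+ 1) (L ℕ.+ j)
      ≈⟨ ·-cong (·-cong ≈-refl (∏<≈∏ (suc j) (geomInv (- (+ 1))))) ≈-refl ⟩
    t (suc j) · geomInv (+ 1) (L ℕ.+ j) ∎
    where open SetoidReasoning setoid

  -- With n = j + 1, expanding 1 / (q; q)_L by (q^(L+1); q)_(n-1) gives the denominator (q;
  -- q)_(L+n-1), which the factor 1 - q^(L+n) of the summand completes to (q; q)_(L+n).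
  invFrom-·-summand : ∀ j → invFrom 0 L · summand L (suc j) ≈ u 0 j
  invFrom-·-summand j = begin
    invFrom 0 L · summand L (suc j)
      ≈⟨ ·-cong (≈-sym (poch-·-invFrom j)) (summand≈ j) ⟩
    poch j · I · (t (suc j) · G)
      ≈⟨ solve 4 (λ p i t g → p :* i :* (t :* g) := p :* (con (+ 1) :* t) :* (i :* g)) ≈-refl (poch j) I (t (suc j)) G ⟩
    poch j · (const (+ 1) · t (suc j)) · (I · G)
      -- For m = 0 the monomial in `w` is `mono (0 * suc j)`, which reduces to `one`.
      ≈⟨ ·-cong (·-cong ≈-refl (·-cong const-1 ≈-refl)) ≈-refl ⟩
    u 0 j ∎
    where
    open SetoidReasoning setoid
    I = invFrom 0 (L ℕ.+ j)
    G = geomInv (+ 1) (L ℕ.+ j)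

  summand-order : ∀ j k → k ℕ.≤ j → summand L (suc j) k ≡ + 0
  summand-order j k k≤j = trans (at factored k) (mono-·-< (suc j) _ k (s≤s k≤j))
    where
    open SetoidReasoning setoid
    N = ∏ (suc j) (geomInv (- (+ 1)))
    G = geomInv (+ 1) (L ℕ.+ j)
    factored : summand L (suc j) ≈ mono (suc j) · (mono (tri j) · N · G)
    factored = begin
      summand L (suc j)
        ≈⟨ summand≈ j ⟩
      mono (tri (suc j)) · N · G
        ≈⟨ ·-cong (·-cong (≈-trans (≡⇒≈ (cong mono (tri-suc j))) (mono-+ (suc j) (tri j))) ≈-refl) ≈-refl ⟩
      mono (suc j) · mono (tri j) · N · G
        ≈⟨ solve 4 (λ a b c d → a :* b :* c :* d := a :* (b :* c :* d)) ≈-refl _ _ _ _ ⟩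
      mono (suc j) · (mono (tri j) · N · G) ∎

  theSeries≡U : ∀ k → theSeries L k ≡ U 0 k
  theSeries≡U k = begin
    (invQPoch L ⊛ innerSum L) k
      ≡⟨ cong (λ f → f k) (·-⊛ (invQPoch L) (innerSum L)) ⟨
    (invQPoch L · innerSum L) k
      -- The number of terms of `innerSum L i` depends on the degree i. For i ≤ k it is padded with
      -- vanishing terms to `suc k`, giving one finite sum of series over which the product
      -- distributes.
      ≡⟨ ·-cong≤ k (λ i _ → at (∏<≈∏ L (geomInv (+ 1))) i) (λ i i≤k → sym (
           trans (∑-at (suc k) _ i) (Σ-truncate (ℕP.m≤n⇒m≤1+n i≤k) (λ j i≤j → summand-order j i i≤j)))) ⟩
    (invFrom 0 L · ∑ (suc k) (λ j → summand L (suc j))) k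
      ≡⟨ at (∑-·ˡ (suc k) (invFrom 0 L) _) k ⟩
    ∑ (suc k) (λ j → invFrom 0 L · summand L (suc j)) k
      ≡⟨ ∑-at (suc k) _ k ⟩
    Σ< (suc k) (λ j → (invFrom 0 L · summand L (suc j)) k)
      ≡⟨ Σ-cong (suc k) (λ j _ → at (invFrom-·-summand j) k) ⟩
    Σ< (suc k) (λ j → u 0 j k)
      ≡⟨ ∑-at (suc k) (u 0) k ⟨
    U 0 k ∎
    where open ≡-Reasoning

-- Gaussian binomials

-- The Gaussian binomial coefficient of n + l over l: partitions into at most l parts, each at most n,
-- classified by their largest part m.
gauss : ℕ → ℕ → PS
gauss zero    n = const (+ 1)
gauss (suc l) n = ∑ (suc n) (λ m → mono m · gauss l m)

gauss-nonneg : ∀ l n k → + 0 ≤ gauss l n k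
gauss-nonneg zero    n k = const-1-nonneg k
gauss-nonneg (suc l) n k = subst (+ 0 ≤_) (sym (∑-at (suc n) _ k))
  (Σ-nonneg (suc n) (λ m → mono-·-nonneg m (gauss-nonneg l m) k))

gauss-mono : ∀ l {m n} → m ℕ.≤ n → ∀ k → gauss l m k ≤ gauss l n k
gauss-mono zero    m≤n k = ℤP.≤-refl
gauss-mono (suc l) {m} {n} m≤n k = begin
  gauss (suc l) m k                          ≡⟨ ∑-at (suc m) _ k ⟩
  Σ< (suc m) (λ i → (mono i · gauss l i) k)  ≤⟨ Σ-extend (s≤s m≤n) (λ i → mono-·-nonneg i (gauss-nonneg l i) k) ⟩
  Σ< (suc n) (λ i → (mono i · gauss l i) k)  ≡⟨ ∑-at (suc n) _ k ⟨
  gauss (suc l) n k                          ∎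
  where open ℤP.≤-Reasoning

gauss-0 : ∀ l → gauss l 0 ≈ const (+ 1)
gauss-0 zero    = ≈-refl
gauss-0 (suc l) = begin
  const (+ 0) ⊕ mono 0 · gauss l 0           ≈⟨ ⊕-cong ≈-refl (·-cong (≈-sym const-1) (gauss-0 l)) ⟩
  const (+ 0) ⊕ const (+ 1) · const (+ 1)    ≈⟨ solve 0 (con (+ 0) :+ con (+ 1) :* con (+ 1) := con (+ 1)) ≈-refl ⟩
  const (+ 1)                                ∎
  where open SetoidReasoning setoid

-- The q-binomial theorem

mono-*-suc : ∀ a n → mono (a ℕ.* suc n) ≈ mono a · mono (a ℕ.* n)
mono-*-suc a n = ≈-trans (≡⇒≈ (cong mono (ℕP.*-suc a n))) (mono-+ a (a ℕ.* n))

factor-·-geometric-sum : ∀ m M →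
  factor m · ∑ M (λ n → mono (suc m ℕ.* n) · const (+ 1)) ≈ const (+ 1) ⊕ ⊖ mono (suc m ℕ.* M)
factor-·-geometric-sum m zero = begin
  factor m · const (+ 0)            ≈⟨ solve 1 (λ f → f :* con (+ 0) := con (+ 1) :+ (:- con (+ 1))) ≈-refl (factor m) ⟩
  const (+ 1) ⊕ ⊖ const (+ 1)       ≈⟨ ⊕-cong ≈-refl (⊖-cong (≈-trans const-1 (≡⇒≈ (cong mono (sym (ℕP.*-zeroʳ (suc m))))))) ⟩
  const (+ 1) ⊕ ⊖ mono (suc m ℕ.* 0) ∎
  where open SetoidReasoning setoid
factor-·-geometric-sum m (suc M) = begin
  factor m · (∑ M (λ n → mono (suc m ℕ.* n) · const (+ 1)) ⊕ Z · const (+ 1))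
    ≈⟨ ·-distribˡ _ _ _ ⟩
  factor m · ∑ M (λ n → mono (suc m ℕ.* n) · const (+ 1)) ⊕ factor m · (Z · const (+ 1))
    ≈⟨ ⊕-cong (factor-·-geometric-sum m M) ≈-refl ⟩
  (const (+ 1) ⊕ ⊖ Z) ⊕ factor m · (Z · const (+ 1))
    ≈⟨ solve 2 (λ z q → (con (+ 1) :+ (:- z)) :+ (con (+ 1) :+ (:- q)) :* (z :* con (+ 1)) := con (+ 1) :+ (:- (q :* z)))
         ≈-refl Z (mono (suc m)) ⟩
  const (+ 1) ⊕ ⊖ (mono (suc m) · Z)
    ≈⟨ ⊕-cong ≈-refl (⊖-cong (mono-*-suc (suc m) M)) ⟨
  const (+ 1) ⊕ ⊖ mono (suc m ℕ.* suc M) ∎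
  where
  open SetoidReasoning setoid
  Z = mono (suc m ℕ.* M)

-- Summation by parts: consecutive values of `gauss (suc l)` differ by q^n `gauss l n`, and the
-- boundary term is divisible by q^((m+1)M).
factor-·-gauss-sum : ∀ l m M →
  factor m · ∑ M (λ n → mono (suc m ℕ.* n) · gauss (suc l) n)
  ≈ ∑ M (λ n → mono (suc (suc m) ℕ.* n) · gauss l n) ⊕ ⊖ (mono (suc m ℕ.* M) · ∑ M (λ n → mono n · gauss l n))
factor-·-gauss-sum l m zero =
  solve 2 (λ f z → f :* con (+ 0) := con (+ 0) :+ (:- (z :* con (+ 0)))) ≈-refl (factor m) (mono (suc m ℕ.* 0))
factor-·-gauss-sum l m (suc M) = begin
  factor m · (∑ M (λ n → mono (suc m ℕ.* n) · gauss (suc l) n) ⊕ Z · (S ⊕ X · G))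
    ≈⟨ ·-distribˡ _ _ _ ⟩
  factor m · ∑ M (λ n → mono (suc m ℕ.* n) · gauss (suc l) n) ⊕ factor m · (Z · (S ⊕ X · G))
    ≈⟨ ⊕-cong (factor-·-gauss-sum l m M) ≈-refl ⟩
  (T ⊕ ⊖ (Z · S)) ⊕ factor m · (Z · (S ⊕ X · G))
    ≈⟨ solve 6 (λ t z s q x g → (t :+ (:- (z :* s))) :+ (con (+ 1) :+ (:- q)) :* (z :* (s :+ x :* g))
                             := (t :+ x :* z :* g) :+ (:- (q :* z :* (s :+ x :* g)))) ≈-refl
         T Z S (mono (suc m)) X G ⟩
  (T ⊕ X · Z · G) ⊕ ⊖ (mono (suc m) · Z · (S ⊕ X · G))
    ≈⟨ ⊕-cong (⊕-cong ≈-refl (·-cong (mono-+ M (suc m ℕ.* M)) ≈-refl)) (⊖-cong (·-cong (mono-*-suc (suc m) M) ≈-refl)) ⟨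
  (T ⊕ mono (suc (suc m) ℕ.* M) · G) ⊕ ⊖ (mono (suc m ℕ.* suc M) · (S ⊕ X · G)) ∎
  where
  open SetoidReasoning setoid
  Z = mono (suc m ℕ.* M)
  X = mono M
  G = gauss l M
  S = ∑ M (λ n → mono n · gauss l n)
  T = ∑ M (λ n → mono (suc (suc m) ℕ.* n) · gauss l n)

⊕-⊖mono-at : ∀ f g m M k → k ℕ.< M → (f ⊕ ⊖ (mono (suc m ℕ.* M) · g)) k ≡ f k
⊕-⊖mono-at f g m M k k<M = begin
  (f ⊕ ⊖ h) k       ≡⟨ ⊕-at f (⊖ h) k ⟩
  f k + (⊖ h) k     ≡⟨ cong (_+_ (f k)) (⊖-at h k) ⟩
  f k + - h k       ≡⟨ cong (λ r → f k + - r) (mono-·-< _ g k (ℕP.<-≤-trans k<M (ℕP.m≤m+n M (m ℕ.* M)))) ⟩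
  f k + + 0         ≡⟨ ℤP.+-identityʳ (f k) ⟩
  f k               ∎
  where
  open ≡-Reasoning
  h = mono (suc m ℕ.* M) · g

cancel-factor : ∀ m {f g} k → (∀ i → i ℕ.≤ k → (factor m · f) i ≡ g i) → f k ≡ (geomInv (+ 1) m · g) k
cancel-factor m {f} {g} k h = trans (at expand k) (·-cong≤ k (λ _ _ → refl) h)
  where
  open SetoidReasoning setoid
  G = geomInv (+ 1) m
  expand : f ≈ G · (factor m · f)
  expand = begin
    f                       ≈⟨ ·-identityˡ f ⟨
    const (+ 1) · f         ≈⟨ ·-cong (factor-·-geomInv m) ≈-refl ⟨
    factor m · G · f        ≈⟨ solve 3 (λ a b c → a :* b :* c := b :* (a :* c)) ≈-refl (factor m) G f ⟩
    G · (factor m · f)      ∎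

-- The infinite sum over n is cut at `M` > k, so boundary terms are invisible in degree `k`.
-- Multiplying by 1 - q^(m+1) lowers l and raises m, which drives the induction on l.
q-binomial-theorem : ∀ l m M k → k ℕ.< M →
                     ∑ M (λ n → mono (suc m ℕ.* n) · gauss l n) k ≡ invFrom m (suc l) k
q-binomial-theorem zero m M k k<M = trans
  (cancel-factor m {g = const (+ 1)} k λ i i≤k →
    trans (at (≈-trans (factor-·-geometric-sum m M) (⊕-cong ≈-refl (⊖-cong (≈-sym (·-identityʳ _))))) i)
          (⊕-⊖mono-at (const (+ 1)) (const (+ 1)) m M i (ℕP.≤-<-trans i≤k k<M)))
  (at (≈-sym (invFrom-front m 0)) k)
q-binomial-theorem (suc l) m M k k<M = trans
  (cancel-factor m {g = invFrom (suc m) (suc l)} k λ i i≤k →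
    let i<M = ℕP.≤-<-trans i≤k k<M in
    trans (at (factor-·-gauss-sum l m M) i)
          (trans (⊕-⊖mono-at _ _ m M i i<M) (q-binomial-theorem l (suc m) M i i<M)))
  (at (≈-sym (invFrom-front m (suc l))) k)

-- Expansion of `A` in Gaussian binomials

open Telescoping using (A)

-- The factor q^(m+1) shifts the sum from n to s = n + 1: this is m + 1 copies of s together with a
-- partition into at most L parts, all less than s.
A-gauss : ∀ L m M k → k ℕ.< M → A L m k ≡ Σ< M (λ n → (mono (suc m ℕ.* suc n) · gauss L n) k)
A-gauss L m M k k<M = begin
  (mono (suc m) · invFrom m (suc L)) k
    ≡⟨ ·-cong≤ k (λ _ _ → refl) (λ i i≤k → sym (q-binomial-theorem L m M i (ℕP.≤-<-trans i≤k k<M))) ⟩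
  (mono (suc m) · ∑ M (λ n → mono (suc m ℕ.* n) · gauss L n)) k
    ≡⟨ at (∑-·ˡ M (mono (suc m)) _) k ⟩
  ∑ M (λ n → mono (suc m) · (mono (suc m ℕ.* n) · gauss L n)) k
    ≡⟨ ∑-at M _ k ⟩
  Σ< M (λ n → (mono (suc m) · (mono (suc m ℕ.* n) · gauss L n)) k)
    ≡⟨ Σ-cong M (λ n _ → at (≈-trans (≈-sym (·-assoc _ _ _)) (·-cong (≈-sym (mono-*-suc (suc m) n)) ≈-refl)) k) ⟩
  Σ< M (λ n → (mono (suc m ℕ.* suc n) · gauss L n) k) ∎
  where open ≡-Reasoning

A-nonneg : ∀ L m k → + 0 ≤ A L m k
A-nonneg L m k = subst (+ 0 ≤_) (sym (A-gauss L m (suc k) k ℕP.≤-refl))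
  (Σ-nonneg (suc k) (λ n → mono-·-nonneg _ (gauss-nonneg L n) k))

-- The injection: `A 0` dominates the sum of the `A` of odd index

module Domination (l k : ℕ) where

  -- The part e next to the weight d is kept apart from it; the remaining at most `l` parts are
  -- bounded by n.
  term : ℕ → ℕ → ℕ → ℤ
  term d e n = (mono d · (mono e · gauss l n)) k

  term-nonneg : ∀ d e n → + 0 ≤ term d e n
  term-nonneg d e n = mono-·-nonneg d (mono-·-nonneg e (gauss-nonneg l n)) k

  term-mono : ∀ d e {m n} → m ℕ.≤ n → term d e m ≤ term d e n
  term-mono d e m≤n = mono-·-mono-≤ d (mono-·-mono-≤ e (gauss-mono l m≤n)) k

  term-cong : ∀ {d e d′ e′} n → d ℕ.+ e ≡ d′ ℕ.+ e′ → term d e n ≡ term d′ e′ n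
  term-cong {d} {e} {d′} {e′} n eq = at (begin
    mono d · (mono e · gauss l n)        ≈⟨ ·-assoc _ _ _ ⟨
    mono d · mono e · gauss l n          ≈⟨ ·-cong (mono-+ d e) ≈-refl ⟨
    mono (d ℕ.+ e) · gauss l n           ≈⟨ ·-cong (≡⇒≈ (cong mono eq)) ≈-refl ⟩
    mono (d′ ℕ.+ e′) · gauss l n         ≈⟨ ·-cong (mono-+ d′ e′) ≈-refl ⟩
    mono d′ · mono e′ · gauss l n        ≈⟨ ·-assoc _ _ _ ⟩
    mono d′ · (mono e′ · gauss l n)      ∎) k
    where open SetoidReasoning setoid

  A-term : ∀ m M → k ℕ.< M → A (suc l) m k ≡ Σ< M (λ n → Σ< (suc n) (λ i → term (suc m ℕ.* suc n) i i))
  A-term m M k<M = trans (A-gauss (suc l) m M k k<M) (Σ-cong M (λ n _ →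
    trans (at (∑-·ˡ (suc n) (mono (suc m ℕ.* suc n)) _) k) (∑-at (suc n) _ k)))

  -- For s = n + 1, the term q^(2(i+1)s) q^m of the Gaussian sum for A (2i+1) is rewritten as q^s q^(s+e) with
  -- e = 2is + m; the pair (i , m) is recovered from e by division, and only e = 0 falls outside the terms of A 0.
  target : ℕ → ℕ → ℤ
  target n zero    = term (suc n) (suc n) 0
  target n (suc d) = term (suc (suc n ℕ.+ d)) (suc n) (suc n)

  target-nonneg : ∀ n e → + 0 ≤ target n e
  target-nonneg n zero    = term-nonneg (suc n) (suc n) 0
  target-nonneg n (suc d) = term-nonneg (suc (suc n ℕ.+ d)) (suc n) (suc n)

  -- The weights agree: (2i+2)s + m = s + (s + e) with e = 2is + m. If e = 0 then m = 0 and the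
  -- terms are equal; otherwise the target allows the remaining parts to reach s instead of m < s,
  -- whence an inequality.
  term≤target : ∀ i n m → m ℕ.≤ n →
                term (suc (suc (i ℕ.* 2)) ℕ.* suc n) m m ≤ target n (i ℕ.* (suc n ℕ.+ suc n) ℕ.+ m)
  term≤target i n m m≤n = lemma _ refl
    where
    s = suc n
    exponent : ∀ i s m → suc (suc (i ℕ.* 2)) ℕ.* s ℕ.+ m ≡ s ℕ.+ s ℕ.+ (i ℕ.* (s ℕ.+ s) ℕ.+ m)
    exponent = ℕSolver.solve-∀
    lemma : ∀ e → i ℕ.* (s ℕ.+ s) ℕ.+ m ≡ e → term (suc (suc (i ℕ.* 2)) ℕ.* s) m m ≤ target n e
    lemma zero eq = ℤP.≤-reflexive (trans
      (term-cong m (trans (exponent i s m) (trans (cong (s ℕ.+ s ℕ.+_) eq) (ℕP.+-identityʳ (s ℕ.+ s)))))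
      (cong (term s s) (ℕP.m+n≡0⇒n≡0 (i ℕ.* (s ℕ.+ s)) eq)))
    lemma (suc d) eq = ℤP.≤-trans
      (ℤP.≤-reflexive (term-cong m (trans (exponent i s m) (trans (cong (s ℕ.+ s ℕ.+_) eq) (regroup s d)))))
      (term-mono (suc (s ℕ.+ d)) s (ℕP.m≤n⇒m≤1+n m≤n))
      where
      regroup : ∀ s d → s ℕ.+ s ℕ.+ suc d ≡ suc (s ℕ.+ d) ℕ.+ s
      regroup = ℕSolver.solve-∀

  module _ (I : ℕ) where

    -- `M` exceeds k, so sums over s may stop there. `M″` is chosen so that every e = 2is + m with i
    -- ≤ I and m < s ≤ M still lies within the range that the expansion of `A 0` offers for s.
    M M″ : ℕ
    M  = suc k
    M″ = suc I ℕ.* (M ℕ.+ M) ℕ.+ M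

    M≤M″ : M ℕ.≤ M″
    M≤M″ = ℕP.m≤n+m M (suc I ℕ.* (M ℕ.+ M))

    ∑-target : Σ< M (λ n → Σ< (suc I) (λ i → Σ< (suc n) (λ m → target n (i ℕ.* (suc n ℕ.+ suc n) ℕ.+ m))))
               ≤ Σ< M (λ n → target n 0) + Σ< M″ (λ n → Σ< (M″ ∸ n) (λ d → target n (suc d)))
    ∑-target = begin
      Σ< M (λ n → Σ< (suc I) (λ i → Σ< (suc n) (λ m → target n (i ℕ.* (suc n ℕ.+ suc n) ℕ.+ m))))
        -- For fixed s the values e = 2is + m are distinct, so each target is used at most once;
        -- then the sum is extended to all e in range.
        ≤⟨ Σ-mono M (λ n n<M → ℤP.≤-trans (Σ-even-blocks (suc I) (suc n) (target-nonneg n))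
                                           (Σ-extend (room n n<M) (target-nonneg n))) ⟩
      Σ< M (λ n → Σ< (suc (M″ ∸ n)) (target n))
        ≡⟨ Σ-cong M (λ n _ → Σ-front (M″ ∸ n) (target n)) ⟩
      Σ< M (λ n → target n 0 + Σ< (M″ ∸ n) (λ d → target n (suc d)))
        ≡⟨ Σ-+ M _ _ ⟩
      Σ< M (λ n → target n 0) + Σ< M (λ n → Σ< (M″ ∸ n) (λ d → target n (suc d)))
        ≤⟨ ℤP.+-monoʳ-≤ (Σ< M (λ n → target n 0))
             (Σ-extend M≤M″ (λ n → Σ-nonneg (M″ ∸ n) (λ d → target-nonneg n (suc d)))) ⟩
      Σ< M (λ n → target n 0) + Σ< M″ (λ n → Σ< (M″ ∸ n) (λ d → target n (suc d))) ∎
      where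
      open ℤP.≤-Reasoning
      room : ∀ n → n ℕ.< M → suc I ℕ.* (suc n ℕ.+ suc n) ℕ.≤ suc (M″ ∸ n)
      room n n<M = ℕP.m≤n⇒m≤1+n (ℕP.≤-trans
        (ℕP.*-monoʳ-≤ (suc I) (ℕP.+-mono-≤ n<M n<M))
        (ℕP.≤-trans (ℕP.≤-reflexive (sym (ℕP.m+n∸n≡m _ M))) (ℕP.∸-monoʳ-≤ M″ (ℕP.<⇒≤ n<M))))

    ∑-target-0 : Σ< M (λ n → target n 0) ≤ Σ< (suc M″) (λ d → term (suc d) 0 0)
    ∑-target-0 = begin
      Σ< M (λ n → target n 0)
        ≡⟨ Σ-cong M (λ n _ → trans (term-cong 0 (regroup n)) (sym (ℤP.+-identityˡ _))) ⟩
      Σ< M (λ n → Σ< 1 (λ m → term (suc (suc (n ℕ.* 2 ℕ.+ m))) 0 0))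
        -- Blocks of length 2 with a half of length 1 pick out the even e; the shift by two makes
        -- them the part sizes 2s.
        ≤⟨ Σ-even-blocks M 1 {λ e → term (suc (suc e)) 0 0} (λ e → term-nonneg (suc (suc e)) 0 0) ⟩
      Σ< (M ℕ.* 2) (λ e → term (suc (suc e)) 0 0)
        ≤⟨ Σ-extend M*2≤M″ (λ e → term-nonneg (suc (suc e)) 0 0) ⟩
      Σ< M″ (λ e → term (suc (suc e)) 0 0)
        ≡⟨ ℤP.+-identityˡ _ ⟨
      + 0 + Σ< M″ (λ e → term (suc (suc e)) 0 0)
        -- The part of size 1 is added, so that all single-part partitions appear.
        ≤⟨ ℤP.+-monoˡ-≤ _ (term-nonneg 1 0 0) ⟩
      term 1 0 0 + Σ< M″ (λ e → term (suc (suc e)) 0 0)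
        ≡⟨ Σ-front M″ _ ⟨
      Σ< (suc M″) (λ d → term (suc d) 0 0) ∎
      where
      open ℤP.≤-Reasoning
      regroup : ∀ n → suc n ℕ.+ suc n ≡ suc (suc (n ℕ.* 2 ℕ.+ 0)) ℕ.+ 0
      regroup = ℕSolver.solve-∀
      double : ∀ M → M ℕ.* 2 ≡ M ℕ.+ M
      double = ℕSolver.solve-∀
      M*2≤M″ : M ℕ.* 2 ℕ.≤ M″
      M*2≤M″ = ℕP.≤-trans (ℕP.≤-reflexive (double M))
        (ℕP.≤-trans (ℕP.m≤m+n (M ℕ.+ M) (I ℕ.* (M ℕ.+ M))) (ℕP.m≤m+n _ M))

    A-0-by-second-part : A (suc l) 0 k
      ≡ Σ< (suc M″) (λ d → term (suc d) 0 0) + Σ< M″ (λ n → Σ< (M″ ∸ n) (λ d → target n (suc d)))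
    A-0-by-second-part = begin
      A (suc l) 0 k
        ≡⟨ A-term 0 (suc M″) (ℕP.m≤n⇒m≤1+n M≤M″) ⟩
      Σ< (suc M″) (λ N → Σ< (suc N) (λ n → term (1 ℕ.* suc N) n n))
        ≡⟨ Σ-cong (suc M″) (λ N _ → cong (λ r → Σ< (suc N) (λ n → term r n n)) (ℕP.*-identityˡ (suc N))) ⟩
      Σ< (suc M″) (λ N → Σ< (suc N) (λ n → term (suc N) n n))
        ≡⟨ Σ-triangle (suc M″) (λ N n → term (suc N) n n) ⟩
      Σ< (suc M″) (λ n → Σ< (suc M″ ∸ n) (λ d → term (suc (n ℕ.+ d)) n n))
        -- The second part n is now outermost. For n = 0 there is a single part; at `suc n` the
        -- summand is `target n (suc d)` by definition.
        ≡⟨ Σ-front M″ _ ⟩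
      Σ< (suc M″) (λ d → term (suc d) 0 0) + Σ< M″ (λ n → Σ< (M″ ∸ n) (λ d → target n (suc d))) ∎
      where open ≡-Reasoning

    ∑-odd-A≤A-0 : Σ< (suc I) (λ i → A (suc l) (suc (i ℕ.* 2)) k) ≤ A (suc l) 0 k
    ∑-odd-A≤A-0 = begin
      Σ< (suc I) (λ i → A (suc l) (suc (i ℕ.* 2)) k)
        ≡⟨ Σ-cong (suc I) (λ i _ → A-term (suc (i ℕ.* 2)) M ℕP.≤-refl) ⟩
      Σ< (suc I) (λ i → Σ< M (λ n → Σ< (suc n) (λ m → term (suc (suc (i ℕ.* 2)) ℕ.* suc n) m m)))
        ≡⟨ Σ-swap (suc I) M _ ⟩
      Σ< M (λ n → Σ< (suc I) (λ i → Σ< (suc n) (λ m → term (suc (suc (i ℕ.* 2)) ℕ.* suc n) m m)))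
        ≤⟨ Σ-mono M (λ n _ → Σ-mono (suc I) (λ i _ → Σ-mono (suc n) λ { m (s≤s m≤n) → term≤target i n m m≤n })) ⟩
      Σ< M (λ n → Σ< (suc I) (λ i → Σ< (suc n) (λ m → target n (i ℕ.* (suc n ℕ.+ suc n) ℕ.+ m))))
        ≤⟨ ∑-target ⟩
      Σ< M (λ n → target n 0) + Σ< M″ (λ n → Σ< (M″ ∸ n) (λ d → target n (suc d)))
        ≤⟨ ℤP.+-monoˡ-≤ _ ∑-target-0 ⟩
      Σ< (suc M″) (λ d → term (suc d) 0 0) + Σ< M″ (λ n → Σ< (M″ ∸ n) (λ d → target n (suc d)))
        ≡⟨ A-0-by-second-part ⟨
      A (suc l) 0 k ∎
      where open ℤP.≤-Reasoning

theorem6p2 : (L : ℕ) → L ≥ 1 → (k : ℕ) → + 0 ≤ theSeries L k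
-- L ≥ 1 supplies the largest part μ_1, which `Domination` splits off.
theorem6p2 (suc l) _ k = begin
  + 0                    ≡⟨ ℤP.+-inverseʳ O ⟨
  O + - O                ≤⟨ ℤP.+-monoˡ-≤ (- O) (Domination.∑-odd-A≤A-0 l k k) ⟩
  A L 0 k + - O          ≡⟨ cong (_+ - O) (ℤP.+-identityˡ (A L 0 k)) ⟨
  Σ< 1 (λ i → A L (i ℕ.* 2) k) + - O
                         -- Only `A 0` is needed against the odd-indexed series; the other
                         -- even-indexed ones are non-negative.
                         ≤⟨ ℤP.+-monoˡ-≤ (- O) (Σ-extend {1} {suc k} {λ i → A L (i ℕ.* 2) k} (s≤s z≤n) (λ i → A-nonneg L (i ℕ.* 2) k)) ⟩
  E + - O                ≡⟨ ℤP.+-identityʳ _ ⟨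
  -- After `suc k` rounds the remainder has index 2(k+1) ≥ k, hence vanishes in degree k.
  E + - O + + 0          ≡⟨ cong (λ r → E + - O + r) (U-order (suc k ℕ.* 2) k k≤) ⟨
  E + - O + U (suc k ℕ.* 2) k  ≡⟨ U-alternating (suc k) k ⟨
  U 0 k                  ≡⟨ theSeries≡U k ⟨
  theSeries L k          ∎
  where
  L = suc l
  open Telescoping L using (U; U-order; U-alternating; theSeries≡U)
  open ℤP.≤-Reasoning
  E = Σ< (suc k) (λ i → A L (i ℕ.* 2) k)
  O = Σ< (suc k) (λ i → A L (suc (i ℕ.* 2)) k)
  k≤ : k ℕ.≤ suc k ℕ.* 2
  k≤ = ℕP.≤-trans (ℕP.n≤1+n k) (ℕP.m≤m*n (suc k) 2)
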